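{- For integers $p\ge 1$ and $n\ge 1$, let $s_p^n$ denote the number of $n$-plexes of order $p$ up to isomorphism (equivalently, the number of isomorphism classes of $(n+1)$-uniform hypergraphs on $p$ vertices). Then for $1\le p\le 9$ and $n=1,2,3$ the values of $s_p^n$ are as follows. For $n=1$: $s_1^1=1$, $s_2^1=2$, $s_3^1=4$, $s_4^1=11$, $s_5^1=34$, $s_6^1=156$, $s_7^1=1044$, $s_8^1=12346$, $s_9^1=274668$. For $n=2$: $s_1^2=1$, $s_2^2=1$, $s_3^2=2$, $s_4^2=5$, $s_5^2=34$, $s_6^2=2136$, $s_7^2=7013320$, $s_8^2=1788782616656$, $s_9^2=53304527811667897248$. For $n=3$: $s_1^3=1$, $s_2^3=1$, $s_3^3=1$, $s_4^3=2$, $s_5^3=6$, $s_6^3=156$, $s_7^3=7013320$, $s_8^3=29281354514767168$, $s_9^3=234431745534048922731115555415680$.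
   Context: An $n$-plex of order $p$ is a simplicial complex with $p$ points (vertices) in which every maximal simplex (a simplex that is not a face of any larger simplex) has dimension $n$ or $0$; the complex consisting of the $p$ points only, with no simplex of dimension $n$, is included in the count. Such a complex is determined by its set of $n$-dimensional simplexes, so an $n$-plex of order $p$ is the same thing as an $(n+1)$-uniform hypergraph on $p$ vertices, i.e. an arbitrary (possibly empty) set of $(n+1)$-element subsets of a $p$-element set. Two are isomorphic if some bijection of the vertex sets carries one family of subsets onto the other. Thus $s_p^n$ is the number of orbits of the symmetric group $S_p$ acting on the set of all families of $(n+1)$-element subsets of $\{1,\dots,p\}$. -}

module Defs where

open import Data.Fin using (Fin)
open import Data.Fin.Permutation as Perm using (Permutation′; _⟨$⟩ˡ_)
open import Data.Fin.Subset using (Subset; Nonempty; _⊆_; _⊂_; ⁅_⁆; ∣_∣)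
open import Data.Nat using (ℕ; suc)
open import Data.Product using (∃; _×_; _,_)
open import Data.Sum using (_⊎_)
open import Data.Vec using (lookup; tabulate)
open import Data.Vec.Properties using (lookup∘tabulate; tabulate∘lookup; tabulate-cong)
open import Function using (Inverse; _⇔_; mk⇔; Equivalence; _∘_)
open import Level using (0ℓ) renaming (suc to lsuc)
open import Relation.Binary using (Setoid)
open import Relation.Binary.PropositionalEquality
  using (_≡_; sym; trans; cong; subst; setoid)
open import Relation.Nullary using (¬_)
open import Relation.Unary using (Pred; Decidable)

-- The simplexes are nonempty vertex sets, and every vertex is one of the
-- p points.  Membership is decidable: a complex is a genuine (finite)
-- family of subsets, i.e. classically just a set of subsets.
record SimplicialComplex (p : ℕ) : Set (lsuc 0ℓ) where
  field
    IsSimplex  : Pred (Subset p) 0ℓ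
    isSimplex? : Decidable IsSimplex
    nonempty   : ∀ {σ} → IsSimplex σ → Nonempty σ
    point      : ∀ v → IsSimplex ⁅ v ⁆
    face       : ∀ {σ τ} → IsSimplex τ → Nonempty σ → σ ⊆ τ → IsSimplex σ

  IsMaximal : Pred (Subset p) 0ℓ
  IsMaximal σ = IsSimplex σ × (∀ {τ} → IsSimplex τ → ¬ (σ ⊂ τ))

open SimplicialComplex public

HasDimension : ∀ {p} → Subset p → ℕ → Set
HasDimension σ d = ∣ σ ∣ ≡ suc d

record Plex (n p : ℕ) : Set (lsuc 0ℓ) where
  field
    complex : SimplicialComplex p
    maximal : ∀ {σ} → IsMaximal complex σ → HasDimension σ n ⊎ HasDimension σ 0

open Plex public

-- v lies in image π σ exactly when π⁻¹ v lies in σ.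
image : ∀ {p} → Permutation′ p → Subset p → Subset p
image π σ = tabulate (λ v → lookup σ (π ⟨$⟩ˡ v))

Isomorphic : ∀ {p} → SimplicialComplex p → SimplicialComplex p → Set
Isomorphic {p} K L =
  ∃ λ (π : Permutation′ p) → ∀ σ → IsSimplex K σ ⇔ IsSimplex L (image π σ)

image-id : ∀ {p} (σ : Subset p) → image Perm.id σ ≡ σ
image-id = tabulate∘lookup

image-∘ : ∀ {p} (π ρ : Permutation′ p) (σ : Subset p) →
          image (π Perm.∘ₚ ρ) σ ≡ image ρ (image π σ)
image-∘ π ρ σ = tabulate-cong λ v → sym (lookup∘tabulate _ (ρ ⟨$⟩ˡ v))

image-flip : ∀ {p} (π : Permutation′ p) (σ : Subset p) →
             image π (image (Perm.flip π) σ) ≡ σ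
image-flip π σ = trans
  (tabulate-cong λ v → trans (lookup∘tabulate _ (π ⟨$⟩ˡ v))
                             (cong (lookup σ) (Perm.inverseʳ π)))
  (tabulate∘lookup σ)

isomorphic-refl : ∀ {p} (K : SimplicialComplex p) → Isomorphic K K
isomorphic-refl K = Perm.id , λ σ →
  mk⇔ (subst (IsSimplex K) (sym (image-id σ))) (subst (IsSimplex K) (image-id σ))

isomorphic-sym : ∀ {p} (K L : SimplicialComplex p) →
                 Isomorphic K L → Isomorphic L K
isomorphic-sym K L (π , e) = Perm.flip π , λ σ → mk⇔
  (Equivalence.from (e _) ∘ subst (IsSimplex L) (sym (image-flip π σ)))
  (subst (IsSimplex L) (image-flip π σ) ∘ Equivalence.to (e _))

isomorphic-trans : ∀ {p} (K L M : SimplicialComplex p) →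
                   Isomorphic K L → Isomorphic L M → Isomorphic K M
isomorphic-trans K L M (π , e) (ρ , f) = (π Perm.∘ₚ ρ) , λ σ → mk⇔
  (subst (IsSimplex M) (sym (image-∘ π ρ σ)) ∘ Equivalence.to (f _) ∘ Equivalence.to (e σ))
  (Equivalence.from (e σ) ∘ Equivalence.from (f _) ∘ subst (IsSimplex M) (image-∘ π ρ σ))

plexSetoid : ℕ → ℕ → Setoid (lsuc 0ℓ) 0ℓ
plexSetoid n p = record
  { Carrier       = Plex n p
  ; _≈_           = λ K L → Isomorphic (complex K) (complex L)
  ; isEquivalence = record
    { refl  = λ {K} → isomorphic-refl (complex K)
    ; sym   = λ {K} {L} → isomorphic-sym (complex K) (complex L)
    ; trans = λ {K} {L} {M} →
        isomorphic-trans (complex K) (complex L) (complex M)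
    }
  }

-- "sₚⁿ = N".  An inverse pair between a setoid and Fin N (with _≡_) is a
-- bijection between the equivalence classes of the setoid and Fin N.
s[_,_]=_ : (n p N : ℕ) → Set (lsuc 0ℓ)
s[ n , p ]= N = Inverse (plexSetoid n p) (setoid (Fin N))

{-# OPTIONS --safe #-}
-- An n-plex is determined by its family of n-dimensional simplexes, so plexes
-- up to isomorphism are the orbits of Sₚ on families of (n+1)-subsets, and
-- Burnside's lemma turns the count into a sum of 2 ^ c(π) over π ∈ Sₚ, where
-- c(π) is the number of orbits of π on the (n+1)-subsets.
--
-- The p! summands are grouped into conjugacy classes by recursion on p: every
-- permutation of p + 1 points is (0 j) ∘ π with π fixing 0, and conjugation by
-- a permutation fixing 0 permutes the choices of j.  Summing over j therefore
-- turns a class function on p + 1 points into one on p points, so it suffices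
-- to extend one representative of each class and to collect conjugate results.
--
-- For each representative, c(π) is found by an unverified search whose result
-- is checked: each k-subset is labelled with an orbit and a rank.
module Submission where

open import Defs
open import Algebra.Properties.CommutativeSemigroup using (interchange; x∙yz≈y∙xz)
open import Data.Bool as Bool using (Bool; true; false; if_then_else_; _∧_; _∨_; T)
import Data.Bool.Properties as Bool
open import Data.Fin as Fin using (Fin; zero; suc; toℕ)
open import Data.Fin.Permutation as Perm
  using (Permutation′; _⟨$⟩ˡ_; _⟨$⟩ʳ_; _∘ₚ_; flip; transpose; lift₀; permutation; inverseˡ; inverseʳ)
  renaming (_≈_ to _≈ₚ_)
import Data.Fin.Properties as Fin
open import Data.Fin.Subset using (Subset; ∣_∣; ⊥; ⁅_⁆; _∈_; _⊆_; _⊂_; Nonempty)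
open import Data.Fin.Subset.Properties
  using (x∈⁅x⁆; x∈⁅y⁆⇒x≡y; ∣⁅x⁆∣≡1; ∣⊥∣≡0; ∣p∣≤n; ⊆-refl; ⊆-trans; ⊆-antisym;
         p⊆q⇒∣p∣≤∣q∣; p⊂q⇒∣p∣<∣q∣; _∈?_; _⊆?_; _⊂?_; nonempty?; anySubset?)
open import Data.List as List
  using (List; []; _∷_; _++_; map; length; filter; foldl; foldr; reverse; allFin; cartesianProductWith)
import Data.List.Membership.Propositional as List
open import Data.List.Membership.Propositional.Properties using (∈-filter⁺; ∈-filter⁻; ∈-lookup)
import Data.List.Properties as List
open import Data.List.Relation.Unary.All as All using (All; []; _∷_)
open import Data.List.Relation.Unary.AllPairs using ([]; _∷_)
open import Data.List.Relation.Unary.Any as Any using (Any)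
open import Data.List.Relation.Unary.Any.Properties using (lookup-index)
open import Data.List.Relation.Unary.Unique.Propositional using (Unique)
import Data.List.Relation.Unary.Unique.Propositional.Properties as Unique
open import Data.Maybe using (Maybe; just; nothing; fromMaybe; zipWith)
open import Data.Nat as ℕ
  using (ℕ; zero; suc; _+_; _*_; _^_; _∸_; _!; _≤_; _<_; _<?_; _≤ᵇ_; _<ᵇ_; _≡ᵇ_; z≤n; s≤s)
open import Data.Nat.Induction using (<-wellFounded)
open import Data.Nat.ListAction using (sum)
open import Data.Nat.Properties
  using (+-commutativeSemigroup; +-assoc; *-comm; *-identityˡ; *-identityʳ; *-zeroʳ;
         *-distribˡ-+; *-distribʳ-+; *-cancelʳ-≡; suc-injective; _!≢0; allUpTo?;
         ≤-reflexive; ≤-trans; ≤-antisym; <-irrefl; m≤n+m; ∸-monoʳ-<)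
open import Data.Product using (∃; ∃₂; _×_; _,_; proj₁; proj₂)
open import Data.Sum using (_⊎_; inj₁; inj₂)
open import Data.Unit using (tt)
open import Data.Vec as Vec using (Vec; []; _∷_; lookup; tabulate)
import Data.Vec.Properties as Vec
open import Function using (_∘_; _⇔_; mk⇔; const; Equivalence; Inverse)
open import Induction.WellFounded using (Acc; acc)
open import Level using (0ℓ)
open import Relation.Binary as B using (Rel; IsEquivalence; Setoid)
open import Relation.Binary.PropositionalEquality as ≡
  using (_≡_; _≗_; refl; sym; trans; cong; cong₂; subst; setoid; module ≡-Reasoning)
open import Relation.Nullary
open import Relation.Nullary.Decidable
  using (_×-dec_; _⊎-dec_; map′; does-⇔; isYes; toWitness; decidable-stable)
open import Relation.Unary using (Pred; Decidable)

private variable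
  A B C P Q : Set
  c k n p : ℕ

-- Finite sums

∑ : List A → (A → ℕ) → ℕ
∑ xs f = sum (map f xs)

-- The Iverson bracket. It inspects only `does`, so its value depends on the truth of `P` and not on
-- the decision procedure.
⟦_⟧ : Dec P → ℕ
⟦ P? ⟧ = if does P? then 1 else 0

⟦⟧-cong : P ⇔ Q → (P? : Dec P) (Q? : Dec Q) → ⟦ P? ⟧ ≡ ⟦ Q? ⟧
⟦⟧-cong P⇔Q P? Q? = cong (if_then 1 else 0) (does-⇔ P⇔Q P? Q?)

⟦⟧-× : (P? : Dec P) (Q? : Dec Q) → ⟦ P? ×-dec Q? ⟧ ≡ ⟦ P? ⟧ * ⟦ Q? ⟧
⟦⟧-× (no _)  Q? = refl
⟦⟧-× (yes _) Q? = sym (*-identityˡ ⟦ Q? ⟧)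

∑-cong : (xs : List A) {f g : A → ℕ} → f ≗ g → ∑ xs f ≡ ∑ xs g
∑-cong xs f≗g = cong sum (List.map-cong f≗g xs)

∑-const : (xs : List A) (c : ℕ) → ∑ xs (const c) ≡ length xs * c
∑-const []       c = refl
∑-const (x ∷ xs) c = cong (c +_) (∑-const xs c)

∑-+ : (xs : List A) (f g : A → ℕ) → ∑ xs (λ x → f x + g x) ≡ ∑ xs f + ∑ xs g
∑-+ []       f g = refl
∑-+ (x ∷ xs) f g = trans (cong (f x + g x +_) (∑-+ xs f g)) (interchange +-commutativeSemigroup (f x) (g x) _ _)

∑-* : (xs : List A) (c : ℕ) (f : A → ℕ) → ∑ xs (λ x → c * f x) ≡ c * ∑ xs f
∑-* []       c f = sym (*-zeroʳ c)
∑-* (x ∷ xs) c f = trans (cong (c * f x +_) (∑-* xs c f)) (sym (*-distribˡ-+ c (f x) _))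

∑-swap : (xs : List A) (ys : List B) (f : A → B → ℕ) →
         ∑ xs (λ x → ∑ ys (f x)) ≡ ∑ ys (λ y → ∑ xs (λ x → f x y))
∑-swap []       ys f = sym (trans (∑-const ys 0) (*-zeroʳ (length ys)))
∑-swap (x ∷ xs) ys f = trans (cong (∑ ys (f x) +_) (∑-swap xs ys f)) (sym (∑-+ ys (f x) _))

∑-++ : (xs ys : List A) (f : A → ℕ) → ∑ (xs ++ ys) f ≡ ∑ xs f + ∑ ys f
∑-++ []       ys f = refl
∑-++ (x ∷ xs) ys f = trans (cong (f x +_) (∑-++ xs ys f)) (sym (+-assoc (f x) _ _))

∑-map : (g : A → B) (xs : List A) (f : B → ℕ) → ∑ (map g xs) f ≡ ∑ xs (f ∘ g)
∑-map g []       f = refl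
∑-map g (x ∷ xs) f = cong (f (g x) +_) (∑-map g xs f)

∑-cartesianProductWith : (h : A → B → C) (xs : List A) (ys : List B) (f : C → ℕ) →
  ∑ (cartesianProductWith h xs ys) f ≡ ∑ xs (λ x → ∑ ys (λ y → f (h x y)))
∑-cartesianProductWith h []       ys f = refl
∑-cartesianProductWith h (x ∷ xs) ys f = trans (∑-++ (map (h x) ys) _ f)
  (cong₂ _+_ (∑-map (h x) ys f) (∑-cartesianProductWith h xs ys f))

∑-filter : {P : Pred A 0ℓ} (P? : Decidable P) (xs : List A) →
           ∑ xs (λ x → ⟦ P? x ⟧) ≡ length (filter P? xs)
∑-filter P? []       = refl
∑-filter P? (x ∷ xs) with does (P? x)
... | true  = cong suc (∑-filter P? xs)
... | false = ∑-filter P? xs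

∑-positive⇒Any : {P : Pred A 0ℓ} (P? : Decidable P) (xs : List A) {n : ℕ} →
                 ∑ xs (λ x → ⟦ P? x ⟧) ≡ suc n → Any P xs
∑-positive⇒Any P? (x ∷ xs) eq with P? x
... | yes Px = Any.here Px
... | no  _  = Any.there (∑-positive⇒Any P? xs eq)

∑≤0⇒All¬ : {P : Pred A 0ℓ} (P? : Decidable P) (xs : List A) →
           ∑ xs (λ x → ⟦ P? x ⟧) ≤ 0 → All (¬_ ∘ P) xs
∑≤0⇒All¬ P? []       _  = []
∑≤0⇒All¬ P? (x ∷ xs) le with P? x
... | no ¬Px = ¬Px ∷ ∑≤0⇒All¬ P? xs le

∑-allFin-suc : ∀ {n} (f : Fin (suc n) → ℕ) →
               ∑ (List.allFin (suc n)) f ≡ f zero + ∑ (List.allFin n) (f ∘ suc)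
∑-allFin-suc {n} f = cong (f zero +_) (trans
  (cong (λ is → ∑ is f) (sym (List.map-tabulate {n = n} (λ i → i) Fin.suc)))
  (∑-map suc (List.allFin n) f))

-- Finite enumerations up to an equivalence

record Enumeration (_≈_ : Rel A 0ℓ) : Set where
  infix 4 _≟_
  field
    isEquivalence : IsEquivalence _≈_
    _≟_           : B.Decidable _≈_
    elements      : List A
    -- Exhaustiveness and absence of repetition in one equation, in the form in which sums use it.
    once          : ∀ a → ∑ elements (λ x → ⟦ x ≟ a ⟧) ≡ 1

  open IsEquivalence isEquivalence public using () renaming (sym to ≈-sym)

  complete : ∀ a → Any (_≈ a) elements
  complete a = ∑-positive⇒Any (_≟ a) elements (once a)

  -- A Kronecker delta: only entries equivalent to `a` contribute, each contributes `f a`, and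
  -- `once` leaves exactly one of them.
  δ : (f : A → ℕ) → (∀ {x y} → x ≈ y → f x ≡ f y) → ∀ a →
      ∑ elements (λ x → ⟦ x ≟ a ⟧ * f x) ≡ f a
  δ f f-cong a = begin
    ∑ elements (λ x → ⟦ x ≟ a ⟧ * f x)  ≡⟨ ∑-cong elements pointwise ⟩
    ∑ elements (λ x → f a * ⟦ x ≟ a ⟧)  ≡⟨ ∑-* elements (f a) _ ⟩
    f a * ∑ elements (λ x → ⟦ x ≟ a ⟧)  ≡⟨ cong (f a *_) (once a) ⟩
    f a * 1                             ≡⟨ *-identityʳ (f a) ⟩
    f a                                 ∎
    where
    open ≡-Reasoning
    pointwise : ∀ x → ⟦ x ≟ a ⟧ * f x ≡ f a * ⟦ x ≟ a ⟧
    pointwise x with x ≟ a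
    ... | yes x≈a = trans (*-identityˡ (f x)) (trans (f-cong x≈a) (sym (*-identityʳ (f a))))
    ... | no  _   = sym (*-zeroʳ (f a))

  ∃? : {P : Pred A 0ℓ} → (∀ {x y} → x ≈ y → P x → P y) → Decidable P → Dec (∃ P)
  ∃? P-resp P? = map′ Any.satisfied
    (λ (a , Pa) → Any.map (λ x≈a → P-resp (≈-sym x≈a) Pa) (complete a))
    (Any.any? P? elements)

open Enumeration

-- The adjunction says that `φ` and `ψ` are inverse up to the two equivalences. Insert a delta at
-- `φ x`, exchange the sums, and turn the delta into one at `ψ y`, which sums to 1.
reindex : {_≈₁_ : Rel A 0ℓ} {_≈₂_ : Rel B 0ℓ} (E : Enumeration _≈₁_) (F : Enumeration _≈₂_)
          (φ : A → B) (ψ : B → A) → (∀ x y → φ x ≈₂ y ⇔ x ≈₁ ψ y) →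
          (f : B → ℕ) → (∀ {x y} → x ≈₂ y → f x ≡ f y) →
          ∑ (elements E) (f ∘ φ) ≡ ∑ (elements F) f
reindex E F φ ψ adj f f-cong = begin
  ∑ xs (λ x → f (φ x))                             ≡⟨ ∑-cong xs (λ x → sym (δ F f f-cong (φ x))) ⟩
  ∑ xs (λ x → ∑ ys (λ y → ⟦ y ≟₂ φ x ⟧ * f y))     ≡⟨ ∑-swap xs ys _ ⟩
  ∑ ys (λ y → ∑ xs (λ x → ⟦ y ≟₂ φ x ⟧ * f y))     ≡⟨ ∑-cong ys (λ y → ∑-cong xs (pointwise y)) ⟩
  ∑ ys (λ y → ∑ xs (λ x → f y * ⟦ x ≟₁ ψ y ⟧))     ≡⟨ ∑-cong ys (λ y → ∑-* xs (f y) _) ⟩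
  ∑ ys (λ y → f y * ∑ xs (λ x → ⟦ x ≟₁ ψ y ⟧))     ≡⟨ ∑-cong ys (λ y → cong (f y *_) (once E (ψ y))) ⟩
  ∑ ys (λ y → f y * 1)                             ≡⟨ ∑-cong ys (λ y → *-identityʳ (f y)) ⟩
  ∑ ys f                                           ∎
  where
  open ≡-Reasoning
  open Enumeration E using () renaming (elements to xs; _≟_ to _≟₁_)
  open Enumeration F using () renaming (elements to ys; _≟_ to _≟₂_)
  pointwise : ∀ y x → ⟦ y ≟₂ φ x ⟧ * f y ≡ f y * ⟦ x ≟₁ ψ y ⟧
  pointwise y x = trans (*-comm _ (f y)) (cong (f y *_) (⟦⟧-cong
    (mk⇔ (λ e → Equivalence.to (adj x y) (≈-sym F e)) (λ e → ≈-sym F (Equivalence.from (adj x y) e)))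
    (y ≟₂ φ x) (x ≟₁ ψ y)))

elements-unique : (E : Enumeration {A} _≡_) → Unique (elements E)
elements-unique E = go (elements E) (λ a → ≤-reflexive (once E a))
  where
  -- The bound is relaxed to at most 1, which tails inherit. The head uses up its own bound, so its
  -- value does not recur in the tail.
  go : ∀ xs → (∀ a → ∑ xs (λ x → ⟦ _≟_ E x a ⟧) ≤ 1) → Unique xs
  go []       _  = []
  go (x ∷ xs) le = All.map (λ y≢x x≡y → y≢x (sym x≡y)) (∑≤0⇒All¬ (λ y → _≟_ E y x) xs zeros) ∷ go xs rest
    where
    zeros : ∑ xs (λ y → ⟦ _≟_ E y x ⟧) ≤ 0
    zeros with _≟_ E x x | le x
    ... | yes _  | s≤s le′ = le′
    ... | no x≢x | _       = contradiction refl x≢x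
    rest : ∀ a → ∑ xs (λ y → ⟦ _≟_ E y a ⟧) ≤ 1
    rest a = ≤-trans (m≤n+m _ ⟦ _≟_ E x a ⟧) (le a)

-- Since equivalence to `c` splits into independent conditions on the two components, the double
-- count factors into a product of two counts equal to 1.
productWith : {_≈₁_ : Rel A 0ℓ} {_≈₂_ : Rel B 0ℓ} {_≈₃_ : Rel C 0ℓ}
  (E : Enumeration _≈₁_) (F : Enumeration _≈₂_) →
  IsEquivalence _≈₃_ → B.Decidable _≈₃_ →
  (h : A → B → C) (fst : C → A) (snd : C → B) →
  (∀ a b c → h a b ≈₃ c ⇔ (a ≈₁ fst c × b ≈₂ snd c)) →
  Enumeration _≈₃_
productWith E F equiv _≟₃_ h fst snd split = record
  { isEquivalence = equiv
  ; _≟_           = _≟₃_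
  ; elements      = cartesianProductWith h (elements E) (elements F)
  ; once          = λ c → begin
      ∑ (cartesianProductWith h xs ys) (λ z → ⟦ z ≟₃ c ⟧)              ≡⟨ ∑-cartesianProductWith h xs ys _ ⟩
      ∑ xs (λ x → ∑ ys (λ y → ⟦ h x y ≟₃ c ⟧))                         ≡⟨ ∑-cong xs (λ x → ∑-cong ys (factor c x)) ⟩
      ∑ xs (λ x → ∑ ys (λ y → ⟦ x ≟₁ fst c ⟧ * ⟦ y ≟₂ snd c ⟧))        ≡⟨ ∑-cong xs (λ x → ∑-* ys ⟦ x ≟₁ fst c ⟧ _) ⟩
      ∑ xs (λ x → ⟦ x ≟₁ fst c ⟧ * ∑ ys (λ y → ⟦ y ≟₂ snd c ⟧))        ≡⟨ ∑-cong xs (λ x → cong (⟦ x ≟₁ fst c ⟧ *_) (once F (snd c))) ⟩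
      ∑ xs (λ x → ⟦ x ≟₁ fst c ⟧ * 1)                                  ≡⟨ ∑-cong xs (λ x → *-identityʳ ⟦ x ≟₁ fst c ⟧) ⟩
      ∑ xs (λ x → ⟦ x ≟₁ fst c ⟧)                                      ≡⟨ once E (fst c) ⟩
      1                                                                ∎
  }
  where
  open ≡-Reasoning
  open Enumeration E using () renaming (elements to xs; _≟_ to _≟₁_)
  open Enumeration F using () renaming (elements to ys; _≟_ to _≟₂_)
  factor : ∀ c x y → ⟦ h x y ≟₃ c ⟧ ≡ ⟦ x ≟₁ fst c ⟧ * ⟦ y ≟₂ snd c ⟧
  factor c x y = trans (⟦⟧-cong (split x y c) (h x y ≟₃ c) (x ≟₁ fst c ×-dec y ≟₂ snd c))
                       (⟦⟧-× (x ≟₁ fst c) (y ≟₂ snd c))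

bools : Enumeration {Bool} _≡_
bools = record
  { isEquivalence = ≡.isEquivalence
  ; _≟_           = Bool._≟_
  ; elements      = true ∷ false ∷ []
  ; once          = λ { true → refl ; false → refl }
  }

fins : ∀ n → Enumeration {Fin n} _≡_
fins n = record
  { isEquivalence = ≡.isEquivalence
  ; _≟_           = Fin._≟_
  ; elements      = List.allFin n
  ; once          = go n
  }
  where
  go : ∀ n (a : Fin n) → ∑ (List.allFin n) (λ x → ⟦ x Fin.≟ a ⟧) ≡ 1
  go (suc n) a = trans (∑-allFin-suc (λ x → ⟦ x Fin.≟ a ⟧)) (split a)
    where
    split : (a : Fin (suc n)) → ⟦ zero Fin.≟ a ⟧ + ∑ (List.allFin n) (λ x → ⟦ suc x Fin.≟ a ⟧) ≡ 1
    split zero    = cong suc (trans (∑-const (List.allFin n) 0) (*-zeroʳ (length (List.allFin n))))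
    split (suc a) = trans (∑-cong (List.allFin n) (λ x → ⟦⟧-cong (mk⇔ Fin.suc-injective (cong suc)) (suc x Fin.≟ suc a) (x Fin.≟ a))) (go n a)

boolVecs : ∀ n → Enumeration {Vec Bool n} _≡_
boolVecs zero = record
  { isEquivalence = ≡.isEquivalence
  ; _≟_           = Vec.≡-dec Bool._≟_
  ; elements      = [] ∷ []
  ; once          = λ { [] → refl }
  }
boolVecs (suc n) = productWith bools (boolVecs n) ≡.isEquivalence (Vec.≡-dec Bool._≟_)
  _∷_ Vec.head Vec.tail
  λ { a b (c ∷ cs) → mk⇔ Vec.∷-injective (λ { (refl , refl) → refl }) }

length-cartesianProductWith : (h : A → B → C) (xs : List A) (ys : List B) →
  length (cartesianProductWith h xs ys) ≡ length xs * length ys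
length-cartesianProductWith h [] ys = refl
length-cartesianProductWith h (x ∷ xs) ys = trans (List.length-++ (map (h x) ys))
  (cong₂ _+_ (List.length-map (h x) ys) (length-cartesianProductWith h xs ys))

length-boolVecs : ∀ n → length (elements (boolVecs n)) ≡ 2 ^ n
length-boolVecs zero    = refl
length-boolVecs (suc n) = trans (length-cartesianProductWith Vec._∷_ (elements bools) (elements (boolVecs n)))
                                (cong (2 *_) (length-boolVecs n))

-- Sums of class functions over the symmetric group

≈ₚ-isEquivalence : IsEquivalence (_≈ₚ_ {p} {p})
≈ₚ-isEquivalence = record
  { refl  = λ i → refl
  ; sym   = λ e i → sym (e i)
  ; trans = λ e f i → trans (e i) (f i)
  }

infix 4 _≟ₚ_
_≟ₚ_ : (π ρ : Permutation′ p) → Dec (π ≈ₚ ρ)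
π ≟ₚ ρ = Fin.all? (λ i → π ⟨$⟩ʳ i Fin.≟ ρ ⟨$⟩ʳ i)

⟨$⟩ʳ-injective : (π : Permutation′ p) {i j : Fin p} → π ⟨$⟩ʳ i ≡ π ⟨$⟩ʳ j → i ≡ j
⟨$⟩ʳ-injective π e = trans (sym (inverseˡ π)) (trans (cong (π ⟨$⟩ˡ_) e) (inverseˡ π))

-- `∘ₚ` applies its left factor first, so this permutation sends 0 to `j`.
extend : Fin (suc p) → Permutation′ p → Permutation′ (suc p)
extend j π = lift₀ π ∘ₚ transpose zero j

restrict : Permutation′ (suc p) → Permutation′ p
restrict σ = Perm.remove zero (σ ∘ₚ flip (transpose zero (σ ⟨$⟩ʳ zero)))

lift₀-restrict : (σ : Permutation′ (suc p)) →
  lift₀ (restrict σ) ≈ₚ σ ∘ₚ flip (transpose zero (σ ⟨$⟩ʳ zero))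
lift₀-restrict σ = Perm.lift₀-remove (σ ∘ₚ flip (transpose zero (σ ⟨$⟩ʳ zero)))
  (inverseˡ (transpose zero (σ ⟨$⟩ʳ zero)) {zero})

-- The image of 0 must be `j`; undoing the transposition of 0 and `j` leaves a permutation fixing 0,
-- which is `π` on the other points. This is the splitting that `productWith` asks for.
extend-split : (j : Fin (suc p)) (π : Permutation′ p) (σ : Permutation′ (suc p)) →
               extend j π ≈ₚ σ ⇔ (j ≡ σ ⟨$⟩ʳ zero × π ≈ₚ restrict σ)
extend-split j π σ = mk⇔ to from
  where
  open ≡-Reasoning
  to : extend j π ≈ₚ σ → j ≡ σ ⟨$⟩ʳ zero × π ≈ₚ restrict σ
  to e with refl ← e zero = refl , λ i → Fin.suc-injective (begin
    suc (π ⟨$⟩ʳ i)                                          ≡⟨ inverseˡ (transpose zero (σ ⟨$⟩ʳ zero)) ⟨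
    transpose zero (σ ⟨$⟩ʳ zero) ⟨$⟩ˡ (extend j π ⟨$⟩ʳ suc i)  ≡⟨ cong (transpose zero (σ ⟨$⟩ʳ zero) ⟨$⟩ˡ_) (e (suc i)) ⟩
    transpose zero (σ ⟨$⟩ʳ zero) ⟨$⟩ˡ (σ ⟨$⟩ʳ suc i)           ≡⟨ lift₀-restrict σ (suc i) ⟨
    suc (restrict σ ⟨$⟩ʳ i)                                 ∎)
  from : j ≡ σ ⟨$⟩ʳ zero × π ≈ₚ restrict σ → extend j π ≈ₚ σ
  from (refl , e) i = begin
    t ⟨$⟩ʳ (lift₀ π ⟨$⟩ʳ i)              ≡⟨ cong (t ⟨$⟩ʳ_) (Perm.lift₀-cong π (restrict σ) e i) ⟩
    t ⟨$⟩ʳ (lift₀ (restrict σ) ⟨$⟩ʳ i)   ≡⟨ cong (t ⟨$⟩ʳ_) (lift₀-restrict σ i) ⟩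
    t ⟨$⟩ʳ (t ⟨$⟩ˡ (σ ⟨$⟩ʳ i))           ≡⟨ inverseʳ t ⟩
    σ ⟨$⟩ʳ i                             ∎
    where t = transpose zero (σ ⟨$⟩ʳ zero)

perms : ∀ p → Enumeration (_≈ₚ_ {p} {p})
perms zero = record
  { isEquivalence = ≈ₚ-isEquivalence
  ; _≟_           = _≟ₚ_
  ; elements      = Perm.id ∷ []
  ; once          = λ _ → refl
  }
perms (suc p) = productWith (fins (suc p)) (perms p) ≈ₚ-isEquivalence _≟ₚ_
  extend (_⟨$⟩ʳ zero) restrict extend-split

length-perms : ∀ p → length (elements (perms p)) ≡ p !
length-perms zero    = refl
length-perms (suc p) = trans (length-cartesianProductWith extend (elements (fins (suc p))) (elements (perms p)))
  (cong₂ _*_ (List.length-tabulate {n = suc p} (λ i → i)) (length-perms p))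

conjugate : Permutation′ p → Permutation′ p → Permutation′ p
conjugate h π = flip h ∘ₚ π ∘ₚ h

transpose-equivariant : (h : Permutation′ p) (i j k : Fin p) →
  h ⟨$⟩ʳ (transpose i j ⟨$⟩ʳ k) ≡ transpose (h ⟨$⟩ʳ i) (h ⟨$⟩ʳ j) ⟨$⟩ʳ (h ⟨$⟩ʳ k)
transpose-equivariant h i j k
  with k Fin.≟ i | h ⟨$⟩ʳ k Fin.≟ h ⟨$⟩ʳ i
... | yes refl | no  hk≢hi = contradiction refl hk≢hi
... | no k≢i   | yes hk≡hi = contradiction (⟨$⟩ʳ-injective h hk≡hi) k≢i
... | yes _    | yes _     = refl
... | no _     | no _
  with k Fin.≟ j | h ⟨$⟩ʳ k Fin.≟ h ⟨$⟩ʳ j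
... | yes refl | no  hk≢hj = contradiction refl hk≢hj
... | no k≢j   | yes hk≡hj = contradiction (⟨$⟩ʳ-injective h hk≡hj) k≢j
... | yes _    | yes _     = refl
... | no _     | no _      = refl

-- Conjugating the transposition of 0 and `j` by `lift₀ h` moves `j` but keeps 0, as `lift₀ h` fixes
-- 0.
extend-conjugate : (h : Permutation′ p) (j : Fin (suc p)) (π : Permutation′ p) →
  extend (lift₀ h ⟨$⟩ʳ j) (conjugate h π) ≈ₚ conjugate (lift₀ h) (extend j π)
extend-conjugate h j π i = trans
  (cong (transpose zero (lift₀ h ⟨$⟩ʳ j) ⟨$⟩ʳ_) (lift₀-conjugate i))
  (sym (transpose-equivariant (lift₀ h) zero j (lift₀ π ⟨$⟩ʳ (lift₀ h ⟨$⟩ˡ i))))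
  where
  lift₀-conjugate : lift₀ (conjugate h π) ≈ₚ conjugate (lift₀ h) (lift₀ π)
  lift₀-conjugate zero    = refl
  lift₀-conjugate (suc i) = refl

record ClassFunction (f : Permutation′ p → ℕ) : Set where
  field
    resp      : ∀ {π ρ} → π ≈ₚ ρ → f π ≡ f ρ
    invariant : ∀ h π → f (conjugate h π) ≡ f π

open ClassFunction

branch : (Permutation′ (suc p) → ℕ) → Permutation′ p → ℕ
branch {p} f π = ∑ (allFin (suc p)) (λ j → f (extend j π))

-- Conjugation by `h` only permutes the summands: by `extend-conjugate` it acts on the index `j`
-- through `lift₀ h`.
branch-classFunction : {f : Permutation′ (suc p) → ℕ} → ClassFunction f → ClassFunction (branch f)
branch-classFunction {p} {f} cf = record
  { resp      = λ {π} {ρ} e → ∑-cong js (λ j → resp cf (λ i →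
                  cong (transpose zero j ⟨$⟩ʳ_) (Perm.lift₀-cong π ρ e i)))
  ; invariant = λ h π → begin
      ∑ js (λ j → f (extend j (conjugate h π)))
        ≡⟨ reindex (fins (suc p)) (fins (suc p)) (lift₀ h ⟨$⟩ʳ_) (lift₀ h ⟨$⟩ˡ_)
             (λ x y → mk⇔ (λ { refl → sym (inverseˡ (lift₀ h)) }) (λ { refl → inverseʳ (lift₀ h) }))
             _ (λ { refl → refl }) ⟨
      ∑ js (λ j → f (extend (lift₀ h ⟨$⟩ʳ j) (conjugate h π)))
        ≡⟨ ∑-cong js (λ j → resp cf (extend-conjugate h j π)) ⟩
      ∑ js (λ j → f (conjugate (lift₀ h) (extend j π)))
        ≡⟨ ∑-cong js (λ j → invariant cf (lift₀ h) (extend j π)) ⟩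
      ∑ js (λ j → f (extend j π)) ∎
  }
  where
  open ≡-Reasoning
  js = allFin (suc p)

-- Tabulating both directions keeps the permutations produced below from
-- growing into towers of compositions that are re-evaluated at every use.
fromTables : (π : Permutation′ p) (v w : Vec (Fin p) p) →
  v ≡ tabulate (π ⟨$⟩ʳ_) → w ≡ tabulate (π ⟨$⟩ˡ_) → Permutation′ p
fromTables π v w refl refl = permutation (lookup v) (lookup w)
  (λ i → trans (Vec.lookup∘tabulate (π ⟨$⟩ʳ_) _) (trans (cong (π ⟨$⟩ʳ_) (Vec.lookup∘tabulate (π ⟨$⟩ˡ_) i)) (inverseʳ π)))
  (λ i → trans (Vec.lookup∘tabulate (π ⟨$⟩ˡ_) _) (trans (cong (π ⟨$⟩ˡ_) (Vec.lookup∘tabulate (π ⟨$⟩ʳ_) i)) (inverseˡ π)))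

memo : Permutation′ p → Permutation′ p
memo π = fromTables π (tabulate (π ⟨$⟩ʳ_)) (tabulate (π ⟨$⟩ˡ_)) refl refl

memo-≈ : (π : Permutation′ p) → memo π ≈ₚ π
memo-≈ π = Vec.lookup∘tabulate (π ⟨$⟩ʳ_)

-- Canonical conjugates

cycleLength : Permutation′ p → Fin p → ℕ
cycleLength {p} π a = go p (π ⟨$⟩ʳ a)
  where
  go : ℕ → Fin p → ℕ
  go zero    b = 1
  go (suc n) b = if does (a Fin.≟ b) then 1 else suc (go n (π ⟨$⟩ʳ b))

longestFrom : Permutation′ p → Fin p → Fin p
longestFrom {p} π i = foldl better i (allFin p)
  where
  better : Fin p → Fin p → Fin p
  better b a = if (toℕ i ≤ᵇ toℕ a) ∧ (cycleLength π b <ᵇ cycleLength π a) then a else b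

-- The point to be moved to position i: the successor of position i - 1 if
-- its cycle is still open, otherwise a point of a longest remaining cycle.
target : Permutation′ p → Fin p → Fin p
target π i =
  if (toℕ i ≡ᵇ 0) ∨ (toℕ (π ⟨$⟩ʳ Fin.pred i) ≤ᵇ toℕ (Fin.pred i))
  then longestFrom π i
  else π ⟨$⟩ʳ Fin.pred i

canonicalAt : Permutation′ p → Fin p → Permutation′ p
canonicalAt π i = memo (conjugate (transpose i (target π i)) π)

-- A conjugate in which the cycles are consecutive intervals of decreasing
-- length.  The proofs only use that it is a conjugate.
canonical : Permutation′ p → Permutation′ p
canonical {p} π = foldl canonicalAt π (allFin p)

canonical-invariant : {f : Permutation′ p → ℕ} → ClassFunction f →
                      ∀ π → f (canonical π) ≡ f π
canonical-invariant {p} {f} cf = go (allFin p)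
  where
  go : ∀ is π → f (foldl canonicalAt π is) ≡ f π
  go []       π = refl
  go (i ∷ is) π = trans (go is (canonicalAt π i))
    (trans (resp cf (memo-≈ (conjugate (transpose i (target π i)) π))) (invariant cf (transpose i (target π i)) π))

-- Weighted lists of class representatives

Weighted : ℕ → Set
Weighted p = List (ℕ × Permutation′ p)

weightedSum : Weighted p → (Permutation′ p → ℕ) → ℕ
weightedSum W f = ∑ W (λ (m , π) → m * f π)

-- Multiplicities are merged only for pointwise equal permutations; applying `canonical` beforehand
-- lets conjugate permutations meet here.
add : ℕ → Permutation′ p → Weighted p → Weighted p
add m π []            = (m , π) ∷ []
add m π ((n , ρ) ∷ W) = if does (π ≟ₚ ρ) then (m + n , ρ) ∷ W else (n , ρ) ∷ add m π W

weightedSum-add : {f : Permutation′ p → ℕ} → ClassFunction f → ∀ m π W →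
                  weightedSum (add m π W) f ≡ m * f π + weightedSum W f
weightedSum-add cf m π [] = refl
weightedSum-add {f = f} cf m π ((n , ρ) ∷ W) = go (π ≟ₚ ρ)
  where
  open ≡-Reasoning
  go : (d : Dec (π ≈ₚ ρ)) →
       weightedSum (if does d then (m + n , ρ) ∷ W else (n , ρ) ∷ add m π W) f
       ≡ m * f π + (n * f ρ + weightedSum W f)
  go (yes π≈ρ) = begin
    (m + n) * f ρ + weightedSum W f        ≡⟨ cong (_+ weightedSum W f) (*-distribʳ-+ (f ρ) m n) ⟩
    m * f ρ + n * f ρ + weightedSum W f    ≡⟨ +-assoc (m * f ρ) _ _ ⟩
    m * f ρ + (n * f ρ + weightedSum W f)  ≡⟨ cong (λ x → m * x + (n * f ρ + weightedSum W f)) (resp cf π≈ρ) ⟨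
    m * f π + (n * f ρ + weightedSum W f)  ∎
  go (no _) = begin
    n * f ρ + weightedSum (add m π W) f    ≡⟨ cong (n * f ρ +_) (weightedSum-add cf m π W) ⟩
    n * f ρ + (m * f π + weightedSum W f)  ≡⟨ x∙yz≈y∙xz +-commutativeSemigroup (n * f ρ) (m * f π) _ ⟩
    m * f π + (n * f ρ + weightedSum W f)  ∎

addExtensions : ℕ × Permutation′ p → Weighted (suc p) → Weighted (suc p)
addExtensions {p} (m , π) W = foldr (λ j → add m (canonical (extend j π))) W (allFin (suc p))

classes : ∀ p → Weighted p
classes zero    = (1 , Perm.id) ∷ []
classes (suc p) = foldr addExtensions [] (classes p)

-- Passing from `extend j π` to its canonical conjugate leaves `f` unchanged, so the new entries add
-- up to `m` times the sum defining `branch f π`.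
weightedSum-addExtensions : {f : Permutation′ (suc p) → ℕ} → ClassFunction f → ∀ m π W →
  weightedSum (addExtensions (m , π) W) f ≡ m * branch f π + weightedSum W f
weightedSum-addExtensions {p} {f} cf m π W = go (allFin (suc p))
  where
  open ≡-Reasoning
  go : ∀ js → weightedSum (foldr (λ j → add m (canonical (extend j π))) W js) f
              ≡ m * ∑ js (λ j → f (extend j π)) + weightedSum W f
  go []       = cong (_+ weightedSum W f) (sym (*-zeroʳ m))
  go (j ∷ js) = begin
    weightedSum (add m (canonical (extend j π)) W′) f                    ≡⟨ weightedSum-add cf m (canonical (extend j π)) W′ ⟩
    m * f (canonical (extend j π)) + weightedSum W′ f                    ≡⟨ cong₂ (λ x y → m * x + y) (canonical-invariant cf (extend j π)) (go js) ⟩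
    m * f (extend j π) + (m * ∑ js _ + weightedSum W f)                  ≡⟨ +-assoc (m * f (extend j π)) _ _ ⟨
    m * f (extend j π) + m * ∑ js _ + weightedSum W f                    ≡⟨ cong (_+ weightedSum W f) (*-distribˡ-+ m (f (extend j π)) _) ⟨
    m * (f (extend j π) + ∑ js (λ j → f (extend j π))) + weightedSum W f ∎
    where W′ = foldr (λ j → add m (canonical (extend j π))) W js

weightedSum-foldr : {f : Permutation′ (suc p) → ℕ} → ClassFunction f → ∀ W →
  weightedSum (foldr addExtensions [] W) f ≡ weightedSum W (branch f)
weightedSum-foldr cf []            = refl
weightedSum-foldr cf ((m , π) ∷ W) = trans (weightedSum-addExtensions cf m π (foldr addExtensions [] W))
  (cong (m * _ +_) (weightedSum-foldr cf W))

-- Induction on `p` for all class functions at once: the hypothesis is applied to `branch f`, which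
-- sums out the choice of `j`.
classSum : ∀ {f : Permutation′ p → ℕ} → ClassFunction f →
           ∑ (elements (perms p)) f ≡ weightedSum (classes p) f
classSum {zero}  {f} cf = cong (_+ 0) (sym (*-identityˡ (f Perm.id)))
classSum {suc p} {f} cf = begin
  ∑ (elements (perms (suc p))) f                                            ≡⟨ ∑-cartesianProductWith extend (allFin (suc p)) (elements (perms p)) f ⟩
  ∑ (allFin (suc p)) (λ j → ∑ (elements (perms p)) (λ π → f (extend j π)))  ≡⟨ ∑-swap (allFin (suc p)) (elements (perms p)) _ ⟩
  ∑ (elements (perms p)) (branch f)                                         ≡⟨ classSum (branch-classFunction cf) ⟩
  weightedSum (classes p) (branch f)                                        ≡⟨ weightedSum-foldr cf (classes p) ⟨
  weightedSum (classes (suc p)) f                                           ∎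
  where open ≡-Reasoning

-- Counting orbits

lookup-injective : {A : Set} {xs : List A} → Unique xs → ∀ i j →
                   List.lookup xs i ≡ List.lookup xs j → i ≡ j
lookup-injective (_ ∷ _)  zero    zero    _ = refl
lookup-injective (x∉ ∷ _) zero    (suc j) e = contradiction e (All.lookup x∉ (∈-lookup j))
lookup-injective (x∉ ∷ _) (suc i) zero    e = contradiction (sym e) (All.lookup x∉ (∈-lookup i))
lookup-injective (_ ∷ u)  (suc i) (suc j) e = cong suc (lookup-injective u i j e)

first : {A : Set} {P : Pred A 0ℓ} → Decidable P → List A → A → A
first P? []       d = d
first P? (x ∷ xs) d = if does (P? x) then x else first P? xs d

first-satisfies : {A : Set} {P : Pred A 0ℓ} (P? : Decidable P) {xs : List A} (d : A) →
                  Any P xs → P (first P? xs d)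
first-satisfies P? {x ∷ xs} d any with P? x | any
... | yes Px | _              = Px
... | no ¬Px | Any.here Px    = contradiction Px ¬Px
... | no _   | Any.there any′ = first-satisfies P? d any′

-- The defaults may differ because a match exists and neither default is returned.
first-cong : {A : Set} {P Q : Pred A 0ℓ} (P? : Decidable P) (Q? : Decidable Q) → (∀ x → P x ⇔ Q x) →
             {xs : List A} (d e : A) → Any P xs → first P? xs d ≡ first Q? xs e
first-cong P? Q? P⇔Q {x ∷ xs} d e any with P? x | Q? x | any
... | yes _  | yes _  | _              = refl
... | yes Px | no ¬Qx | _              = contradiction (Equivalence.to (P⇔Q x) Px) ¬Qx
... | no ¬Px | yes Qx | _              = contradiction (Equivalence.from (P⇔Q x) Qx) ¬Px
... | no ¬Px | no _   | Any.here Px    = contradiction Px ¬Px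
... | no _   | no _   | Any.there any′ = first-cong P? Q? P⇔Q d e any′

-- As `∘ₚ` applies its left factor first, the last law is that of an ordinary left action.
module Orbits {p : ℕ} {A : Set} (E : Enumeration {A} _≡_)
  (_∙_ : Permutation′ p → A → A)
  (∙-cong : ∀ {π ρ} → π ≈ₚ ρ → ∀ x → π ∙ x ≡ ρ ∙ x)
  (id-∙ : ∀ x → Perm.id ∙ x ≡ x)
  (∘-∙ : ∀ π ρ x → (π ∘ₚ ρ) ∙ x ≡ ρ ∙ (π ∙ x))
  where

  infix 4 _∼_
  _∼_ : A → A → Set
  x ∼ y = ∃ λ π → π ∙ x ≡ y

  flip-∙ : ∀ π x → flip π ∙ (π ∙ x) ≡ x
  flip-∙ π x = trans (sym (∘-∙ π (flip π) x)) (trans (∙-cong (λ i → inverseˡ π) x) (id-∙ x))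

  ∙-flip : ∀ π x → π ∙ (flip π ∙ x) ≡ x
  ∙-flip π x = trans (sym (∘-∙ (flip π) π x)) (trans (∙-cong (λ i → inverseʳ π) x) (id-∙ x))

  ∙-adjoint : ∀ π x y → π ∙ x ≡ y ⇔ x ≡ flip π ∙ y
  ∙-adjoint π x y = mk⇔ (λ { refl → sym (flip-∙ π x) }) (λ { refl → ∙-flip π y })

  ∼-refl : ∀ {x} → x ∼ x
  ∼-refl = Perm.id , id-∙ _

  ∼-sym : ∀ {x y} → x ∼ y → y ∼ x
  ∼-sym (π , refl) = flip π , flip-∙ π _

  ∼-trans : ∀ {x y z} → x ∼ y → y ∼ z → x ∼ z
  ∼-trans (π , refl) (ρ , refl) = π ∘ₚ ρ , ∘-∙ π ρ _

  _∼?_ : ∀ x y → Dec (x ∼ y)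
  x ∼? y = ∃? (perms p) (λ π≈ρ e → trans (sym (∙-cong π≈ρ x)) e) (λ π → _≟_ E (π ∙ x) y)

  -- The choice depends only on the orbit of `x` and the order of the enumeration, which makes it
  -- constant on orbits (`rep-cong`).
  rep : A → A
  rep x = first (_∼? x) (elements E) x

  private
    ∼-any : ∀ x → Any (_∼ x) (elements E)
    ∼-any x = Any.map (λ { refl → ∼-refl }) (complete E x)

  rep-∼ : ∀ x → rep x ∼ x
  rep-∼ x = first-satisfies (_∼? x) x (∼-any x)

  rep-cong : ∀ {x y} → x ∼ y → rep x ≡ rep y
  rep-cong {x} {y} x∼y = first-cong (_∼? x) (_∼? y)
    (λ z → mk⇔ (λ z∼x → ∼-trans z∼x x∼y) (λ z∼y → ∼-trans z∼y (∼-sym x∼y))) x y (∼-any x)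

  IsRep : Pred A 0ℓ
  IsRep x = rep x ≡ x

  isRep? : Decidable IsRep
  isRep? x = _≟_ E (rep x) x

  rep-isRep : ∀ x → IsRep (rep x)
  rep-isRep x = rep-cong (rep-∼ x)

  reps : List A
  reps = filter isRep? (elements E)

  fixedPoints : Permutation′ p → ℕ
  fixedPoints π = ∑ (elements E) (λ x → ⟦ _≟_ E (π ∙ x) x ⟧)

  -- Acting by `h` carries the fixed points of `π` bijectively onto those of its conjugate by `h`.
  fixedPoints-classFunction : ClassFunction fixedPoints
  fixedPoints-classFunction = record
    { resp      = λ π≈ρ → ∑-cong (elements E) (λ x →
                    cong (λ y → ⟦ _≟_ E y x ⟧) (∙-cong π≈ρ x))
    ; invariant = λ h π → trans
        (sym (reindex E E (h ∙_) (flip h ∙_) (∙-adjoint h) _ (λ { refl → refl })))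
        (∑-cong (elements E) (λ x → ⟦⟧-cong (conjugate-fixes h π x)
          (_≟_ E (conjugate h π ∙ (h ∙ x)) (h ∙ x)) (_≟_ E (π ∙ x) x)))
    }
    where
    conjugate-fixes : ∀ h π x → conjugate h π ∙ (h ∙ x) ≡ h ∙ x ⇔ π ∙ x ≡ x
    conjugate-fixes h π x = mk⇔
      (λ e → trans (sym (flip-∙ h (π ∙ x))) (trans (cong (flip h ∙_) (trans (sym simplify) e)) (flip-∙ h x)))
      (λ e → trans simplify (cong (h ∙_) e))
      where
      simplify : conjugate h π ∙ (h ∙ x) ≡ h ∙ (π ∙ x)
      simplify = trans (∘-∙ (flip h) (π ∘ₚ h) (h ∙ x))
        (trans (∘-∙ π h _) (cong (λ y → h ∙ (π ∙ y)) (flip-∙ h x)))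

  -- Translating by a permutation taking rep x to x turns π x = x into
  -- π (rep x) = x; substituting x = π y then leaves rep y = y.
  burnside : ∑ (elements (perms p)) fixedPoints ≡ length (elements (perms p)) * length reps
  burnside = begin
    ∑ G (λ π → ∑ X (λ x → ⟦ π ∙ x ≟′ x ⟧))                  ≡⟨ ∑-swap G X _ ⟩
    ∑ X (λ x → ∑ G (λ π → ⟦ π ∙ x ≟′ x ⟧))                  ≡⟨ ∑-cong X translate ⟩
    ∑ X (λ x → ∑ G (λ π → ⟦ π ∙ rep x ≟′ x ⟧))              ≡⟨ ∑-swap X G _ ⟩
    ∑ G (λ π → ∑ X (λ x → ⟦ π ∙ rep x ≟′ x ⟧))              ≡⟨ ∑-cong G (λ π → reindex E E (π ∙_) (flip π ∙_) (∙-adjoint π) _ (λ { refl → refl })) ⟨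
    ∑ G (λ π → ∑ X (λ y → ⟦ π ∙ rep (π ∙ y) ≟′ π ∙ y ⟧))    ≡⟨ ∑-cong G (λ π → ∑-cong X (λ y → ⟦⟧-cong (cancel π y) (π ∙ rep (π ∙ y) ≟′ π ∙ y) (isRep? y))) ⟩
    ∑ G (λ π → ∑ X (λ y → ⟦ isRep? y ⟧))                    ≡⟨ ∑-const G _ ⟩
    length G * ∑ X (λ y → ⟦ isRep? y ⟧)                     ≡⟨ cong (length G *_) (∑-filter isRep? X) ⟩
    length G * length reps                                  ∎
    where
    open ≡-Reasoning
    G = elements (perms p)
    X = elements E
    infix 4 _≟′_
    _≟′_ = _≟_ E
    translate : ∀ x → ∑ G (λ π → ⟦ π ∙ x ≟′ x ⟧) ≡ ∑ G (λ π → ⟦ π ∙ rep x ≟′ x ⟧)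
    translate x with rep x | rep-∼ x
    ... | r | (h , refl) = trans
      (∑-cong G (λ π → cong (λ y → ⟦ y ≟′ h ∙ r ⟧) (sym (∘-∙ h π r))))
      (reindex (perms p) (perms p) (h ∘ₚ_) (flip h ∘ₚ_)
        (λ π ρ → mk⇔
          (λ e i → trans (cong (π ⟨$⟩ʳ_) (sym (inverseʳ h))) (e (h ⟨$⟩ˡ i)))
          (λ e i → trans (e (h ⟨$⟩ʳ i)) (cong (ρ ⟨$⟩ʳ_) (inverseˡ h))))
        (λ π → ⟦ π ∙ r ≟′ h ∙ r ⟧)
        (λ π≈ρ → cong (λ y → ⟦ y ≟′ h ∙ r ⟧) (∙-cong π≈ρ r)))
    cancel : ∀ π y → π ∙ rep (π ∙ y) ≡ π ∙ y ⇔ rep y ≡ y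
    cancel π y = mk⇔
      (λ e → trans (sym (flip-∙ π (rep y))) (trans (cong (flip π ∙_) (trans (cong (π ∙_) (sym repπy)) e)) (flip-∙ π y)))
      (λ e → cong (π ∙_) (trans repπy e))
      where
      repπy : rep (π ∙ y) ≡ rep y
      repπy = rep-cong (∼-sym (π , refl))

  private
    rep∈reps : ∀ x → rep x List.∈ reps
    rep∈reps x = ∈-filter⁺ isRep? (Any.map sym (complete E (rep x))) (rep-isRep x)

    reps-unique : Unique reps
    reps-unique = Unique.filter⁺ isRep? (elements-unique E)

  orbitIndex : A → Fin (length reps)
  orbitIndex x = Any.index (rep∈reps x)

  lookup-orbitIndex : ∀ x → List.lookup reps (orbitIndex x) ≡ rep x
  lookup-orbitIndex x = sym (lookup-index (rep∈reps x))

  orbitIndex-cong : ∀ {x y} → x ∼ y → orbitIndex x ≡ orbitIndex y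
  orbitIndex-cong {x} {y} x∼y = lookup-injective reps-unique _ _
    (trans (lookup-orbitIndex x) (trans (rep-cong x∼y) (sym (lookup-orbitIndex y))))

  orbitIndex-lookup : ∀ i → orbitIndex (List.lookup reps i) ≡ i
  orbitIndex-lookup i = lookup-injective reps-unique _ _ (trans (lookup-orbitIndex _)
    (proj₂ (∈-filter⁻ isRep? {xs = elements E} (∈-lookup i))))

  -- Equivalence classes of `S` correspond to orbits through `F`. A class is sent to the position of
  -- its orbit representative in `reps`, and the section `G` leads back.
  quotient : ∀ {a ℓ} (S : Setoid a ℓ) → let open Setoid S renaming (_≈_ to _≈ₛ_) in
             (F : Carrier → A) (G : A → Carrier) →
             (∀ s t → s ≈ₛ t ⇔ F s ∼ F t) → (∀ x → F (G x) ≡ x) →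
             Inverse S (setoid (Fin (length reps)))
  quotient S F G F-iso FG = record
    { to        = to
    ; from      = from
    ; to-cong   = to-cong
    ; from-cong = λ { refl → Setoid.refl S }
    ; inverse   = (λ {i} s≈ → trans (to-cong s≈) (to-from i))
                , (λ { {s} refl → Equivalence.from (F-iso _ _) (FG-rep s) })
    }
    where
    to : Setoid.Carrier S → Fin (length reps)
    to s = orbitIndex (F s)
    from : Fin (length reps) → Setoid.Carrier S
    from i = G (List.lookup reps i)
    to-cong : ∀ {s t} → Setoid._≈_ S s t → to s ≡ to t
    to-cong s≈t = orbitIndex-cong (Equivalence.to (F-iso _ _) s≈t)
    to-from : ∀ i → to (from i) ≡ i
    to-from i = trans (cong orbitIndex (FG _)) (orbitIndex-lookup i)
    FG-rep : ∀ s → F (from (to s)) ∼ F s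
    FG-rep s = ∼-trans (Perm.id , trans (id-∙ _) (trans (FG _) (lookup-orbitIndex (F s)))) (rep-∼ (F s))

-- Families of k-subsets

-- One value for every k-subset of Fin p; on subsets of another size find
-- returns a junk value.
data Trie (A : Set) : ℕ → ℕ → Set where
  leaf : A → Trie A 0 p
  none : Trie A (suc k) 0
  node : Trie A k p → Trie A (suc k) p → Trie A (suc k) (suc p)

find : A → Trie A k p → Subset p → A
find d (leaf a)   s           = a
find d none       s           = d
find d (node l r) (true  ∷ s) = find d l s
find d (node l r) (false ∷ s) = find d r s

trie : ∀ k p → (Subset p → A) → Trie A k p
trie zero    p       f = leaf (f ⊥)
trie (suc k) zero    f = none
trie (suc k) (suc p) f = node (trie k p (f ∘ (true ∷_))) (trie (suc k) p (f ∘ (false ∷_)))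

insertAt : Subset p → A → Trie A k p → Trie A k p
insertAt s           a (leaf _)   = leaf a
insertAt s           a none       = none
insertAt (true  ∷ s) a (node l r) = node (insertAt s a l) r
insertAt (false ∷ s) a (node l r) = node l (insertAt s a r)

allTrue : Trie Bool k p → Bool
allTrue (leaf b)   = b
allTrue none       = true
allTrue (node l r) = allTrue l ∧ allTrue r

∣s∣≡0⇒s≡⊥ : (s : Subset p) → ∣ s ∣ ≡ 0 → s ≡ ⊥
∣s∣≡0⇒s≡⊥ []          _ = refl
∣s∣≡0⇒s≡⊥ (false ∷ s) e = cong (false ∷_) (∣s∣≡0⇒s≡⊥ s e)

-- The size condition keeps the path away from `none`; at a leaf the rest of the set is empty, which
-- is where `f` was sampled.
find-trie : ∀ k p (d : A) (f : Subset p → A) s → ∣ s ∣ ≡ k → find d (trie k p f) s ≡ f s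
find-trie zero    p       d f s           e = cong f (sym (∣s∣≡0⇒s≡⊥ s e))
find-trie (suc k) (suc p) d f (true  ∷ s) e = find-trie k p d (f ∘ (true ∷_)) s (suc-injective e)
find-trie (suc k) (suc p) d f (false ∷ s) e = find-trie (suc k) p d (f ∘ (false ∷_)) s e

-- Tries are first-order data, so agreement on `k`-subsets becomes propositional equality, and
-- families can be enumerated up to `_≡_`.
trie-cong : ∀ k p {f g : Subset p → A} → (∀ s → ∣ s ∣ ≡ k → f s ≡ g s) → trie k p f ≡ trie k p g
trie-cong zero    p       f≗g = cong leaf (f≗g ⊥ (∣⊥∣≡0 p))
trie-cong (suc k) zero    f≗g = refl
trie-cong (suc k) (suc p) f≗g = cong₂ node
  (trie-cong k p (λ s e → f≗g (true ∷ s) (cong suc e)))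
  (trie-cong (suc k) p (λ s e → f≗g (false ∷ s) e))

trie-find : (d : A) (t : Trie A k p) → trie k p (find d t) ≡ t
trie-find d (leaf a)   = refl
trie-find d none       = refl
trie-find d (node l r) = cong₂ node (trie-find d l) (trie-find d r)

allTrue-sound : (t : Trie Bool k p) → T (allTrue t) → ∀ s → ∣ s ∣ ≡ k → T (find false t s)
allTrue-sound (leaf b)   b≡true s           e = b≡true
allTrue-sound none       _      []          ()
allTrue-sound (node l r) lr     (true  ∷ s) e =
  allTrue-sound l (proj₁ (Equivalence.to Bool.T-∧ lr)) s (suc-injective e)
allTrue-sound (node l r) lr     (false ∷ s) e =
  allTrue-sound r (proj₂ (Equivalence.to (Bool.T-∧ {allTrue l}) lr)) s e

Family : ℕ → ℕ → Set
Family = Trie Bool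

node-injective : {l l′ : Trie A k p} {r r′ : Trie A (suc k) p} →
                 node l r ≡ node l′ r′ → l ≡ l′ × r ≡ r′
node-injective refl = refl , refl

_≟ₜ_ : (x y : Family k p) → Dec (x ≡ y)
leaf a   ≟ₜ leaf b     = map′ (cong leaf) (λ { refl → refl }) (a Bool.≟ b)
none     ≟ₜ none       = yes refl
node l r ≟ₜ node l′ r′ = map′ (λ { (refl , refl) → refl }) node-injective (l ≟ₜ l′ ×-dec r ≟ₜ r′)

families : ∀ k p → Enumeration {Family k p} _≡_
families zero p = record
  { isEquivalence = ≡.isEquivalence
  ; _≟_           = _≟ₜ_
  ; elements      = leaf true ∷ leaf false ∷ []
  ; once          = λ { (leaf true) → refl ; (leaf false) → refl }
  }
families (suc k) zero = record
  { isEquivalence = ≡.isEquivalence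
  ; _≟_           = _≟ₜ_
  ; elements      = none ∷ []
  ; once          = λ { none → refl }
  }
families (suc k) (suc p) = productWith (families k p) (families (suc k) p) ≡.isEquivalence _≟ₜ_
  node (λ { (node l r) → l }) (λ { (node l r) → r })
  λ { l r (node l′ r′) → mk⇔ node-injective λ { (refl , refl) → refl } }

-- The action of permutations on families

∣s∣≡∑ : (s : Subset p) → ∣ s ∣ ≡ ∑ (allFin p) (λ v → if lookup s v then 1 else 0)
∣s∣≡∑ []       = refl
∣s∣≡∑ (b ∷ s) = trans (∣b∷s∣ b) (trans (cong ((if b then 1 else 0) +_) (∣s∣≡∑ s))
  (sym (∑-allFin-suc (λ v → if lookup (b ∷ s) v then 1 else 0))))
  where
  ∣b∷s∣ : ∀ b → ∣ b ∷ s ∣ ≡ (if b then 1 else 0) + ∣ s ∣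
  ∣b∷s∣ true  = refl
  ∣b∷s∣ false = refl

-- With cardinality written as a sum over points, taking the image is a change of index.
∣image∣ : (π : Permutation′ p) (s : Subset p) → ∣ image π s ∣ ≡ ∣ s ∣
∣image∣ {p} π s = begin
  ∣ image π s ∣                                              ≡⟨ ∣s∣≡∑ (image π s) ⟩
  ∑ (allFin p) (λ v → if lookup (image π s) v then 1 else 0) ≡⟨ ∑-cong (allFin p) (λ v → cong (if_then 1 else 0) (Vec.lookup∘tabulate _ v)) ⟩
  ∑ (allFin p) (λ v → if lookup s (π ⟨$⟩ˡ v) then 1 else 0)  ≡⟨ reindex (fins p) (fins p) (π ⟨$⟩ˡ_) (π ⟨$⟩ʳ_)
                                                                 (λ v w → mk⇔ (λ { refl → sym (inverseʳ π) }) (λ { refl → inverseˡ π }))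
                                                                 (λ v → if lookup s v then 1 else 0) (λ { refl → refl }) ⟩
  ∑ (allFin p) (λ v → if lookup s v then 1 else 0)           ≡⟨ ∣s∣≡∑ s ⟨
  ∣ s ∣                                                      ∎
  where open ≡-Reasoning

infixr 8 _∙_
-- The direct image of a family: a set lies in it when its preimage under `π` lies in `x`.
_∙_ : Permutation′ p → Family k p → Family k p
_∙_ {p} {k} π x = trie k p (λ s → find false x (image (flip π) s))

find-∙ : (π : Permutation′ p) (x : Family k p) (s : Subset p) → ∣ s ∣ ≡ k →
         find false (π ∙ x) s ≡ find false x (image (flip π) s)
find-∙ π x = find-trie _ _ false (λ s → find false x (image (flip π) s))

∙-cong : {π ρ : Permutation′ p} → π ≈ₚ ρ → (x : Family k p) → π ∙ x ≡ ρ ∙ x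
∙-cong π≈ρ x = trie-cong _ _ λ s _ → cong (find false x) (Vec.tabulate-cong (λ v → cong (lookup s) (π≈ρ v)))

id-∙ : (x : Family k p) → Perm.id ∙ x ≡ x
id-∙ x = trans (trie-cong _ _ λ s _ → cong (find false x) (image-id s)) (trie-find false x)

∘-∙ : (π ρ : Permutation′ p) (x : Family k p) → (π ∘ₚ ρ) ∙ x ≡ ρ ∙ π ∙ x
∘-∙ π ρ x = trie-cong _ _ λ s e → trans
  (cong (find false x) (image-∘ (flip ρ) (flip π) s))
  (sym (find-∙ π x (image (flip ρ) s) (trans (∣image∣ (flip ρ) s) e)))

module FamilyOrbits (k p : ℕ) = Orbits (families k p) _∙_
  (λ {π} {ρ} → ∙-cong {π = π} {ρ}) id-∙ ∘-∙

-- Indexing by `ℕ` with a default lets orbit numbers be plain numbers, with bounds proved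
-- separately.
nth : A → Vec A c → ℕ → A
nth d []       i       = d
nth d (a ∷ as) zero    = a
nth d (a ∷ as) (suc i) = nth d as i

nth-ext : (d : A) (as bs : Vec A c) → (∀ i → i < c → nth d as i ≡ nth d bs i) → as ≡ bs
nth-ext d []       []       e = refl
nth-ext d (a ∷ as) (b ∷ bs) e = cong₂ _∷_ (e 0 (s≤s z≤n)) (nth-ext d as bs (λ i i<c → e (suc i) (s≤s i<c)))

nth-map : {B : Set} (f : A → B) (d : A) (e : B) (as : Vec A c) → ∀ i → i < c →
          nth e (Vec.map f as) i ≡ f (nth d as i)
nth-map f d e (a ∷ as) zero    _         = refl
nth-map f d e (a ∷ as) (suc i) (s≤s i<c) = nth-map f d e as i i<c

-- The fields force the fibres of orbit to be the τ-orbits of the k-subsets: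
-- a step of τ lowers the rank unless the representative has been reached.
record OrbitCertificate (k p c : ℕ) (τ : Subset p → Subset p) : Set where
  field
    orbit          : Subset p → ℕ
    rank           : Subset p → ℕ
    orbitRep       : Vec (Subset p) c
    orbit-<        : ∀ s → ∣ s ∣ ≡ k → orbit s < c
    orbit-τ        : ∀ s → ∣ s ∣ ≡ k → orbit (τ s) ≡ orbit s
    descends       : ∀ s → ∣ s ∣ ≡ k → rank (τ s) < rank s ⊎ nth ⊥ orbitRep (orbit s) ≡ s
    ∣orbitRep∣     : ∀ j → j < c → ∣ nth ⊥ orbitRep j ∣ ≡ k
    orbit-orbitRep : ∀ j → j < c → orbit (nth ⊥ orbitRep j) ≡ j

-- A family is fixed exactly when it is a union of orbits of `τ` on the `k`-subsets, hence is given
-- by one Boolean per orbit; `union` and `values` translate between the two.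
fixedPoints≡2^orbits : (π : Permutation′ p) → OrbitCertificate k p c (image (flip π)) →
                       FamilyOrbits.fixedPoints k p π ≡ 2 ^ c
fixedPoints≡2^orbits {p} {k} {c} π cert = begin
  ∑ X (λ x → ⟦ (π ∙ x) ≟ₜ′ x ⟧)                  ≡⟨ ∑-cong X fixed≡∑unions ⟩
  ∑ X (λ x → ∑ Z (λ z → ⟦ x ≟ₜ′ union z ⟧))      ≡⟨ ∑-swap X Z _ ⟩
  ∑ Z (λ z → ∑ X (λ x → ⟦ x ≟ₜ′ union z ⟧))      ≡⟨ ∑-cong Z (λ z → once (families k p) (union z)) ⟩
  ∑ Z (const 1)                                  ≡⟨ ∑-const Z 1 ⟩
  length Z * 1                                   ≡⟨ *-identityʳ _ ⟩
  length Z                                       ≡⟨ length-boolVecs c ⟩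
  2 ^ c                                          ∎
  where
  open ≡-Reasoning
  open OrbitCertificate cert
  X = elements (families k p)
  Z = elements (boolVecs c)
  _≟ₜ′_ = _≟_ (families k p)
  τ = image (flip π)

  union : Vec Bool c → Family k p
  union z = trie k p (λ s → nth false z (orbit s))

  find-union : ∀ z s → ∣ s ∣ ≡ k → find false (union z) s ≡ nth false z (orbit s)
  find-union z = find-trie k p false (λ s → nth false z (orbit s))

  union-fixed : ∀ z → π ∙ union z ≡ union z
  union-fixed z = trie-cong k p λ s e → trans
    (find-union z (τ s) (trans (∣image∣ (flip π) s) e)) (cong (nth false z) (orbit-τ s e))

  values : Family k p → Vec Bool c
  values x = Vec.map (find false x) orbitRep

  nth-values : ∀ x j → j < c → nth false (values x) j ≡ find false x (nth ⊥ orbitRep j)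
  nth-values x = nth-map (find false x) ⊥ false orbitRep

  values-union : ∀ z → values (union z) ≡ z
  values-union z = nth-ext false _ z λ j j<c → trans (nth-values (union z) j j<c)
    (trans (find-union z _ (∣orbitRep∣ j j<c)) (cong (nth false z) (orbit-orbitRep j j<c)))

  -- Well-founded descent on the rank: for a fixed `x`, passing from `s` to `τ s` changes neither
  -- membership nor orbit number, and the descent stops at the representative.
  constant : ∀ x → π ∙ x ≡ x → ∀ s → ∣ s ∣ ≡ k → Acc _<_ (rank s) →
             find false x (nth ⊥ orbitRep (orbit s)) ≡ find false x s
  constant x fix s e (acc rs) with descends s e
  ... | inj₂ rep≡s = cong (find false x) rep≡s
  ... | inj₁ τs<s  = begin
    find false x (nth ⊥ orbitRep (orbit s))      ≡⟨ cong (find false x ∘ nth ⊥ orbitRep) (orbit-τ s e) ⟨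
    find false x (nth ⊥ orbitRep (orbit (τ s)))  ≡⟨ constant x fix (τ s) (trans (∣image∣ (flip π) s) e) (rs τs<s) ⟩
    find false x (τ s)                           ≡⟨ find-∙ π x s e ⟨
    find false (π ∙ x) s                         ≡⟨ cong (λ y → find false y s) fix ⟩
    find false x s                               ∎

  union-values : ∀ x → π ∙ x ≡ x → union (values x) ≡ x
  union-values x fix = trans
    (trie-cong k p λ s e → trans (nth-values x (orbit s) (orbit-< s e)) (constant x fix s e (<-wellFounded _)))
    (trie-find false x)

  -- A fixed `x` is the union for `values x` and for no other vector; any other `x` is not a union
  -- at all.
  fixed≡∑unions : ∀ x → ⟦ (π ∙ x) ≟ₜ′ x ⟧ ≡ ∑ Z (λ z → ⟦ x ≟ₜ′ union z ⟧)
  fixed≡∑unions x with (π ∙ x) ≟ₜ′ x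
  ... | yes fix = sym (trans (∑-cong Z λ z → ⟦⟧-cong (mk⇔
          (λ { refl → sym (values-union z) })
          (λ { refl → sym (union-values x fix) })) (x ≟ₜ′ union z) (_≟_ (boolVecs c) z (values x)))
          (once (boolVecs c) (values x)))
  ... | no ¬fix = sym (trans (∑-cong Z λ z → ⟦⟧-cong (mk⇔
          (λ { refl → ¬fix (union-fixed z) }) λ ()) (x ≟ₜ′ union z) (no λ ()))
          (trans (∑-const Z 0) (*-zeroʳ (length Z))))

-- Counting the orbits of a permutation on k-subsets

subsets : (k p : ℕ) → List (Subset p)
subsets zero    p       = ⊥ ∷ []
subsets (suc k) zero    = []
subsets (suc k) (suc p) = map (true ∷_) (subsets k p) ++ map (false ∷_) (subsets (suc k) p)

-- The permutation enters as a table, so that it can be shared by all the images computed in the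
-- search and the check.
imageTable : Vec (Fin p) p → Subset p → Subset p
imageTable v s = Vec.map (lookup s) v

imageTable-tabulate : (π : Permutation′ p) (s : Subset p) →
                      imageTable (tabulate (π ⟨$⟩ʳ_)) s ≡ image (flip π) s
imageTable-tabulate π s = sym (Vec.tabulate-∘ (lookup s) (π ⟨$⟩ʳ_))

-- Orbit number and rank of the subsets visited so far.
Labels : ℕ → ℕ → Set
Labels = Trie (Maybe (ℕ × ℕ))

labelOrbit : ℕ → (Subset p → Subset p) → ℕ → ℕ → Subset p → Labels k p → Labels k p
labelOrbit zero       f j r s t = t
labelOrbit (suc fuel) f j r s t with find nothing t s
... | just _  = t
... | nothing = labelOrbit fuel f j (suc r) (f s) (insertAt s (just (j , r)) t)

visit : (Subset p → Subset p) → Labels k p × ℕ × List (Subset p) → Subset p →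
        Labels k p × ℕ × List (Subset p)
visit {p} f (t , j , reps) s with find nothing t s
... | just _  = t , j , reps
-- The fuel is the number of all subsets, which bounds the length of any orbit.
... | nothing = labelOrbit (2 ^ p) f j 0 s t , suc j , s ∷ reps

searchOrbits : ∀ k → (Subset p → Subset p) → Labels k p × List (Subset p)
searchOrbits {p} k f with foldl (visit f) (trie k p (const nothing) , 0 , []) (subsets k p)
... | t , _ , reps = t , reverse reps

label : Labels k p → Subset p → ℕ × ℕ
label t s = fromMaybe (0 , 0) (find nothing t s)

module _ (k : ℕ) (τ : Subset p → Subset p) (t : Labels k p) (reps : Vec (Subset p) c) where

  private
    orbit rank : Subset p → ℕ
    orbit s = proj₁ (label t s)
    rank  s = proj₂ (label t s)

    OrbitStep : Pred (Subset p) 0ℓ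
    OrbitStep s = orbit s < c × orbit (τ s) ≡ orbit s × (rank (τ s) < rank s ⊎ nth ⊥ reps (orbit s) ≡ s)

    orbitStep? : Decidable OrbitStep
    orbitStep? s = orbit s <? c ×-dec orbit (τ s) ℕ.≟ orbit s ×-dec
                   (rank (τ s) <? rank s ⊎-dec Vec.≡-dec Bool._≟_ (nth ⊥ reps (orbit s)) s)

    OrbitBase : Pred ℕ 0ℓ
    OrbitBase j = ∣ nth ⊥ reps j ∣ ≡ k × orbit (nth ⊥ reps j) ≡ j

    orbitBase? : Decidable OrbitBase
    orbitBase? j = ∣ nth ⊥ reps j ∣ ℕ.≟ k ×-dec orbit (nth ⊥ reps j) ℕ.≟ j

  -- Going through a trie tests each `k`-subset once, instead of running over all subsets of the
  -- points.
  certified : Bool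
  certified = allTrue (trie k p (isYes ∘ orbitStep?)) ∧ isYes (allUpTo? orbitBase? c)

  certificate : T certified → OrbitCertificate k p c τ
  certificate ok = record
    { orbit          = orbit
    ; rank           = rank
    ; orbitRep       = reps
    ; orbit-<        = λ s e → proj₁ (step s e)
    ; orbit-τ        = λ s e → proj₁ (proj₂ (step s e))
    ; descends       = λ s e → proj₂ (proj₂ (step s e))
    ; ∣orbitRep∣     = λ j j<c → proj₁ (base j<c)
    ; orbit-orbitRep = λ j j<c → proj₂ (base j<c)
    }
    where
    oks : T (allTrue (trie k p (isYes ∘ orbitStep?))) × T (isYes (allUpTo? orbitBase? c))
    oks = Equivalence.to Bool.T-∧ ok
    step : ∀ s → ∣ s ∣ ≡ k → OrbitStep s
    step s e = toWitness {a? = orbitStep? s} (subst T (find-trie k p false (isYes ∘ orbitStep?) s e)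
      (allTrue-sound (trie k p (isYes ∘ orbitStep?)) (proj₁ oks) s e))
    base : ∀ {j} → j < c → OrbitBase j
    base = toWitness {a? = allUpTo? orbitBase? c} (proj₂ oks)

certifiedCount : ∀ k → (Subset p → Subset p) → Labels k p × List (Subset p) → Maybe ℕ
certifiedCount k τ (t , reps) =
  if certified k τ t (Vec.fromList reps) then just (length reps) else nothing

-- The search follows the inverse of the permutation x ↦ x ∘ π of the subsets,
-- so that the rank decreases along the permutation itself.
orbitCount : ∀ k → Permutation′ p → Maybe ℕ
orbitCount k π = certifiedCount k (imageTable (tabulate (π ⟨$⟩ʳ_)))
  (searchOrbits k (imageTable (tabulate (π ⟨$⟩ˡ_))))

if-just : (b : Bool) {a a′ : A} → (if b then just a else nothing) ≡ just a′ → T b × a ≡ a′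
if-just true refl = tt , refl

-- The computed table agrees with `image (flip π)` only pointwise, so the two fields that mention
-- `τ` are transported.
certificate-cong : {τ υ : Subset p → Subset p} → (∀ s → τ s ≡ υ s) →
                   OrbitCertificate k p c τ → OrbitCertificate k p c υ
certificate-cong τ≗υ cert = record
  { OrbitCertificate cert
  ; orbit-τ  = λ s e → trans (cong orbit (sym (τ≗υ s))) (orbit-τ s e)
  ; descends = λ s e → subst (λ u → rank u < rank s ⊎ nth ⊥ orbitRep (orbit s) ≡ s) (τ≗υ s) (descends s e)
  }
  where open OrbitCertificate cert

-- `L` is arbitrary: a successful check alone supplies the certificate, whatever search produced the
-- labels.
certifiedCount-sound : (τ : Subset p → Subset p) (L : Labels k p × List (Subset p)) →
  certifiedCount k τ L ≡ just c → OrbitCertificate k p c τ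
certifiedCount-sound {k = k} τ (t , reps) e
  with refl ← proj₂ (if-just (certified k τ t (Vec.fromList reps)) e)
  = certificate k τ t (Vec.fromList reps) (proj₁ (if-just (certified k τ t (Vec.fromList reps)) e))

orbitCount-sound : ∀ k (π : Permutation′ p) → orbitCount k π ≡ just c →
                   FamilyOrbits.fixedPoints k p π ≡ 2 ^ c
orbitCount-sound k π e = fixedPoints≡2^orbits π (certificate-cong (imageTable-tabulate π)
  (certifiedCount-sound (imageTable (tabulate (π ⟨$⟩ʳ_))) (searchOrbits k _) e))

fixedPointSum : ∀ k → Weighted p → Maybe ℕ
fixedPointSum k []            = just 0
fixedPointSum k ((m , π) ∷ W) = zipWith (λ c b → m * 2 ^ c + b) (orbitCount k π) (fixedPointSum k W)

zipWith-just : {B C : Set} (f : A → B → C) (a : Maybe A) (b : Maybe B) {z : C} →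
               zipWith f a b ≡ just z → ∃₂ λ x y → a ≡ just x × b ≡ just y × f x y ≡ z
zipWith-just f (just x) (just y) refl = x , y , refl , refl , refl

fixedPointSum-sound : ∀ k (W : Weighted p) {N} → fixedPointSum k W ≡ just N →
                      weightedSum W (FamilyOrbits.fixedPoints k p) ≡ N
fixedPointSum-sound k []            refl = refl
fixedPointSum-sound k ((m , π) ∷ W) e
  with c , b , c≡ , b≡ , refl ← zipWith-just _ (orbitCount k π) (fixedPointSum k W) e
  = cong₂ (λ x y → m * x + y) (orbitCount-sound k π c≡) (fixedPointSum-sound k W b≡)

-- Plexes as families

∣s∣≡1⇒s≡⁅v⁆ : (s : Subset p) → ∣ s ∣ ≡ 1 → ∃ λ v → s ≡ ⁅ v ⁆
∣s∣≡1⇒s≡⁅v⁆ (true  ∷ s) e = zero , cong (true ∷_) (∣s∣≡0⇒s≡⊥ s (suc-injective e))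
∣s∣≡1⇒s≡⁅v⁆ (false ∷ s) e with v , s≡ ← ∣s∣≡1⇒s≡⁅v⁆ s e = suc v , cong (false ∷_) s≡

∣s∣>0⇒nonempty : (s : Subset p) → 0 < ∣ s ∣ → Nonempty s
∣s∣>0⇒nonempty (true  ∷ s) _  = zero , Vec.here
∣s∣>0⇒nonempty (false ∷ s) lt with v , v∈s ← ∣s∣>0⇒nonempty s lt = suc v , Vec.there v∈s

nonempty⇒∣s∣>0 : {s : Subset p} → Nonempty s → 0 < ∣ s ∣
nonempty⇒∣s∣>0 {s = s} (v , v∈s) = ≤-trans (≤-reflexive (sym (∣⁅x⁆∣≡1 v)))
  (p⊆q⇒∣p∣≤∣q∣ (λ x∈ → subst (_∈ s) (sym (x∈⁅y⁆⇒x≡y v x∈)) v∈s))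

⊆∧⊄⇒≡ : {s t : Subset p} → s ⊆ t → ¬ (s ⊂ t) → s ≡ t
⊆∧⊄⇒≡ {s = s} s⊆t s⊄t = ⊆-antisym s⊆t λ {v} v∈t →
  decidable-stable (v ∈? s) (λ v∉s → s⊄t (s⊆t , v , v∈t , v∉s))

⊆∧∣∣≡⇒≡ : {s t : Subset p} → s ⊆ t → ∣ s ∣ ≡ ∣ t ∣ → s ≡ t
⊆∧∣∣≡⇒≡ s⊆t e = ⊆∧⊄⇒≡ s⊆t (λ s⊂t → <-irrefl e (p⊂q⇒∣p∣<∣q∣ s⊂t))

nonempty-⊆ : {s t : Subset p} → Nonempty s → s ⊆ t → Nonempty t
nonempty-⊆ (v , v∈s) s⊆t = v , s⊆t v∈s

image-⊆ : (π : Permutation′ p) {s t : Subset p} → s ⊆ t → image π s ⊆ image π t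
image-⊆ π {s} {t} s⊆t {v} v∈ = Vec.lookup⇒[]= v _ (trans (Vec.lookup∘tabulate _ v)
  (Vec.[]=⇒lookup (s⊆t (Vec.lookup⇒[]= (π ⟨$⟩ˡ v) s
    (trans (sym (Vec.lookup∘tabulate _ v)) (Vec.[]=⇒lookup v∈))))))

image-nonempty : (π : Permutation′ p) {s : Subset p} → Nonempty s → Nonempty (image π s)
image-nonempty π {s} ne = ∣s∣>0⇒nonempty (image π s)
  (subst (0 <_) (sym (∣image∣ π s)) (nonempty⇒∣s∣>0 ne))

family : Plex n p → Family (suc n) p
family {n} {p} K = trie (suc n) p (does ∘ isSimplex? (complex K))

find-family : (K : Plex n p) (s : Subset p) → HasDimension s n →
              find false (family K) s ≡ does (isSimplex? (complex K) s)
find-family K = find-trie _ _ false (does ∘ isSimplex? (complex K))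

-- Move to a strictly larger simplex as long as the finite search finds one; `p ∸ ∣ s ∣` decreases
-- each time.
maximalAbove : (K : SimplicialComplex p) → ∀ {s} → IsSimplex K s → ∃ λ t → IsMaximal K t × s ⊆ t
maximalAbove {p} K {s} = go s (<-wellFounded _)
  where
  go : ∀ s → Acc _<_ (p ∸ ∣ s ∣) → IsSimplex K s → ∃ λ t → IsMaximal K t × s ⊆ t
  go s (acc rs) Ks with anySubset? (λ t → isSimplex? K t ×-dec s ⊂? t)
  ... | no ¬∃t = s , (Ks , λ Kt s⊂t → ¬∃t (_ , Kt , s⊂t)) , ⊆-refl
  ... | yes (t , Kt , s⊂t)
    with u , max , t⊆u ← go t (rs (∸-monoʳ-< (p⊂q⇒∣p∣<∣q∣ s⊂t) (∣p∣≤n t))) Kt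
    = u , max , ⊆-trans (proj₁ s⊂t) t⊆u

-- With `P` the family of top simplexes, this characterises the nonempty sets that are simplexes of
-- a plex, and so lets the complex be recovered from the family.
Supported : (Subset p → Set) → ℕ → Subset p → Set
Supported P n s = ∣ s ∣ ≡ 1 ⊎ ∃ λ t → HasDimension t n × P t × s ⊆ t

-- A maximal simplex above `s` has dimension `n` or 0; in the second case the nonempty `s` is that
-- single point.
simplex-supported : (K : Plex n p) → ∀ {s} → IsSimplex (complex K) s → Supported (IsSimplex (complex K)) n s
simplex-supported K {s} Ks with maximalAbove (complex K) Ks
... | t , max , s⊆t with maximal K max
...   | inj₁ ∣t∣≡1+n = inj₂ (t , ∣t∣≡1+n , proj₁ max , s⊆t)
...   | inj₂ ∣t∣≡1   = inj₁ (≤-antisym (subst (∣ s ∣ ≤_) ∣t∣≡1 (p⊆q⇒∣p∣≤∣q∣ s⊆t))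
                                       (nonempty⇒∣s∣>0 (nonempty (complex K) Ks)))

-- Preservation need only be checked in dimension `n`: points go to points, and a face of a top
-- simplex goes to a face of its image.
image-simplex : (K L : Plex n p) (π : Permutation′ p) →
  (∀ t → HasDimension t n → IsSimplex (complex K) t → IsSimplex (complex L) (image π t)) →
  ∀ {s} → IsSimplex (complex K) s → IsSimplex (complex L) (image π s)
image-simplex K L π onTop {s} Ks with simplex-supported K Ks
... | inj₁ ∣s∣≡1 with v , eq ← ∣s∣≡1⇒s≡⁅v⁆ (image π s) (trans (∣image∣ π s) ∣s∣≡1)
      = subst (IsSimplex (complex L)) (sym eq) (point (complex L) v)
... | inj₂ (t , dim , Kt , s⊆t) = face (complex L) (onTop t dim Kt)
      (image-nonempty π (nonempty (complex K) Ks)) (image-⊆ π s⊆t)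

open FamilyOrbits using (_∼_)

-- Forwards, restrict the isomorphism to dimension `n`. Backwards, `image-simplex` spreads agreement
-- in dimension `n` to all simplexes, once for `π` and once for its inverse.
isomorphic⇔∼ : (K L : Plex n p) → Isomorphic (complex K) (complex L) ⇔ _∼_ (suc n) p (family K) (family L)
isomorphic⇔∼ {n} {p} K L = mk⇔ to from
  where
  open ≡-Reasoning
  K? = isSimplex? (complex K)
  L? = isSimplex? (complex L)

  dim-image : ∀ (π : Permutation′ p) s → HasDimension s n → HasDimension (image π s) n
  dim-image π s e = trans (∣image∣ π s) e

  to : Isomorphic (complex K) (complex L) → _∼_ (suc n) p (family K) (family L)
  to (π , iso) = π , trie-cong (suc n) p λ s e → trans
    (find-family K (image (flip π) s) (dim-image (flip π) s e))
    (does-⇔ (mk⇔ (subst (IsSimplex (complex L)) (image-flip π s) ∘ Equivalence.to (iso _))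
                 (Equivalence.from (iso _) ∘ subst (IsSimplex (complex L)) (sym (image-flip π s))))
            (K? (image (flip π) s)) (L? s))

  does≡⇒ : {P Q : Set} (P? : Dec P) (Q? : Dec Q) → does P? ≡ does Q? → P → Q
  does≡⇒ (yes _) (yes q) _ _ = q
  does≡⇒ (no ¬p) _       _ p = contradiction p ¬p

  from : _∼_ (suc n) p (family K) (family L) → Isomorphic (complex K) (complex L)
  from (π , e) = π , λ s → mk⇔
    (image-simplex K L π λ t dim → does≡⇒ (K? t) (L? (image π t)) (agree t dim))
    (λ Ls → subst (IsSimplex (complex K)) (image-flip (flip π) s)
      (image-simplex L K (flip π) (λ t dim → does≡⇒ (L? t) (K? (image (flip π) t)) (sym (agree′ t dim))) Ls))
    where
    agree′ : ∀ t → HasDimension t n → does (K? (image (flip π) t)) ≡ does (L? t)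
    agree′ t dim = begin
      does (K? (image (flip π) t))            ≡⟨ find-family K (image (flip π) t) (dim-image (flip π) t dim) ⟨
      find false (family K) (image (flip π) t) ≡⟨ find-∙ π (family K) t dim ⟨
      find false (π ∙ family K) t             ≡⟨ cong (λ x → find false x t) e ⟩
      find false (family L) t                 ≡⟨ find-family L t dim ⟩
      does (L? t)                             ∎
    agree : ∀ t → HasDimension t n → does (K? t) ≡ does (L? (image π t))
    agree t dim = trans (cong (does ∘ K?) (sym (image-flip (flip π) t))) (agree′ (image π t) (dim-image π t dim))

-- The plex generated by a family

module _ (x : Family (suc (suc n)) p) where

  private
    InFamily : Subset p → Set
    InFamily t = find false x t ≡ true

    Simplex : Subset p → Set
    Simplex s = Nonempty s × Supported InFamily (suc n) s

    simplex? : Decidable Simplex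
    simplex? s = nonempty? s ×-dec (∣ s ∣ ℕ.≟ 1 ⊎-dec
      anySubset? λ t → ∣ t ∣ ℕ.≟ suc (suc n) ×-dec find false x t Bool.≟ true ×-dec s ⊆? t)

  plex : Plex (suc n) p
  plex = record
    { complex = record
      { IsSimplex  = Simplex
      ; isSimplex? = simplex?
      ; nonempty   = proj₁
      ; point      = λ v → (v , x∈⁅x⁆ v) , inj₁ (∣⁅x⁆∣≡1 v)
      ; face       = λ (_ , supp) ne s⊆t → ne , supported-⊆ supp ne s⊆t
      }
    ; maximal = λ { ((_ , inj₁ ∣s∣≡1) , _) → inj₂ ∣s∣≡1
                  -- The member `t` of the family is itself a simplex, so a maximal `s` inside it
                  -- equals `t`.
                  ; ((ne , inj₂ (t , dim , t∈x , s⊆t)) , max) → inj₁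
                      (trans (cong ∣_∣ (⊆∧⊄⇒≡ s⊆t (max (nonempty-⊆ ne s⊆t , inj₂ (t , dim , t∈x , ⊆-refl))))) dim) }
    }
    where
    supported-⊆ : ∀ {s t} → Supported InFamily (suc n) t → Nonempty s → s ⊆ t → Supported InFamily (suc n) s
    supported-⊆ {s} (inj₁ ∣t∣≡1) ne s⊆t =
      inj₁ (≤-antisym (subst (∣ s ∣ ≤_) ∣t∣≡1 (p⊆q⇒∣p∣≤∣q∣ s⊆t)) (nonempty⇒∣s∣>0 ne))
    supported-⊆ (inj₂ (u , dim , u∈x , t⊆u)) ne s⊆t = inj₂ (u , dim , u∈x , ⊆-trans s⊆t t⊆u)

  family-plex : family plex ≡ x
  family-plex = trans (trie-cong _ _ agree) (trie-find false x)
    where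
    inFamily : ∀ s → HasDimension s (suc n) → Simplex s → InFamily s
    -- Positive dimension matters here: every point is a simplex, but no set of `n + 2` elements is
    -- a point.
    inFamily s dim (_ , inj₁ ∣s∣≡1) with () ← trans (sym dim) ∣s∣≡1
    inFamily s dim (_ , inj₂ (t , dim′ , t∈x , s⊆t)) =
      subst InFamily (sym (⊆∧∣∣≡⇒≡ s⊆t (trans dim (sym dim′)))) t∈x
    agree : ∀ s → HasDimension s (suc n) → does (simplex? s) ≡ find false x s
    agree s dim = trans
      (does-⇔ (mk⇔ (inFamily s dim)
                   (λ s∈x → ∣s∣>0⇒nonempty s (subst (0 <_) (sym dim) (s≤s z≤n)) , inj₂ (s , dim , s∈x , ⊆-refl)))
              (simplex? s) (find false x s Bool.≟ true))
      (does-≟-true (find false x s))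
      where
      does-≟-true : ∀ b → does (b Bool.≟ true) ≡ b
      does-≟-true true  = refl
      does-≟-true false = refl

-- Burnside equates the evaluated sum with `p !` times the number of orbits, and cancelling `p !`
-- leaves `N`. The subsets have `n + 2` elements because the dimension is `suc n`.
plexCount : ∀ n p N → fixedPointSum (suc (suc n)) (classes p) ≡ just (N * p !) → s[ suc n , p ]= N
plexCount n p N eq = subst (s[ suc n , p ]=_) count
  (quotient (plexSetoid (suc n) p) family plex isomorphic⇔∼ family-plex)
  where
  open FamilyOrbits (suc (suc n)) p using (quotient; burnside; fixedPoints; fixedPoints-classFunction; reps)
  open ≡-Reasoning
  count : length reps ≡ N
  count = *-cancelʳ-≡ _ _ (p !) {{p !≢0}} (begin
    length reps * p !                                      ≡⟨ *-comm (length reps) (p !) ⟩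
    p ! * length reps                                      ≡⟨ cong (_* length reps) (length-perms p) ⟨
    length (elements (perms p)) * length reps              ≡⟨ burnside ⟨
    ∑ (elements (perms p)) fixedPoints                     ≡⟨ classSum fixedPoints-classFunction ⟩
    weightedSum (classes p) fixedPoints                    ≡⟨ fixedPointSum-sound (suc (suc n)) (classes p) eq ⟩
    N * p !                                                ∎)

mainTheorem1 : (s[ 1 , 1 ]= 1)
    × (s[ 1 , 2 ]= 2)
    × (s[ 1 , 3 ]= 4)
    × (s[ 1 , 4 ]= 11)
    × (s[ 1 , 5 ]= 34)
    × (s[ 1 , 6 ]= 156)
    × (s[ 1 , 7 ]= 1044)
    × (s[ 1 , 8 ]= 12346)
    × (s[ 1 , 9 ]= 274668)
    × (s[ 2 , 1 ]= 1)
    × (s[ 2 , 2 ]= 1)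
    × (s[ 2 , 3 ]= 2)
    × (s[ 2 , 4 ]= 5)
    × (s[ 2 , 5 ]= 34)
    × (s[ 2 , 6 ]= 2136)
    × (s[ 2 , 7 ]= 7013320)
    × (s[ 2 , 8 ]= 1788782616656)
    × (s[ 2 , 9 ]= 53304527811667897248)
    × (s[ 3 , 1 ]= 1)
    × (s[ 3 , 2 ]= 1)
    × (s[ 3 , 3 ]= 1)
    × (s[ 3 , 4 ]= 2)
    × (s[ 3 , 5 ]= 6)
    × (s[ 3 , 6 ]= 156)
    × (s[ 3 , 7 ]= 7013320)
    × (s[ 3 , 8 ]= 29281354514767168)
    × (s[ 3 , 9 ]= 234431745534048922731115555415680)
-- The first argument is the dimension minus one. Each `refl` makes the type checker evaluate the
-- certified sum and compare it with `N * p !`.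
mainTheorem1 =
    plexCount 0 1 1 refl
  , plexCount 0 2 2 refl
  , plexCount 0 3 4 refl
  , plexCount 0 4 11 refl
  , plexCount 0 5 34 refl
  , plexCount 0 6 156 refl
  , plexCount 0 7 1044 refl
  , plexCount 0 8 12346 refl
  , plexCount 0 9 274668 refl
  , plexCount 1 1 1 refl
  , plexCount 1 2 1 refl
  , plexCount 1 3 2 refl
  , plexCount 1 4 5 refl
  , plexCount 1 5 34 refl
  , plexCount 1 6 2136 refl
  , plexCount 1 7 7013320 refl
  , plexCount 1 8 1788782616656 refl
  , plexCount 1 9 53304527811667897248 refl
  , plexCount 2 1 1 refl
  , plexCount 2 2 1 refl
  , plexCount 2 3 1 refl
  , plexCount 2 4 2 refl
  , plexCount 2 5 6 refl
  , plexCount 2 6 156 refl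
  , plexCount 2 7 7013320 refl
  , plexCount 2 8 29281354514767168 refl
  , plexCount 2 9 234431745534048922731115555415680 refl
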